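{- For every $\xi>0$ and every integer $k\geq 3$, there is a $k$-uniform hypergraph $F$ with $0<\gamma(F)<\xi$.
   Context: A $k$-uniform hypergraph ($k$-graph) $H$ consists of a vertex set $V(H)$ and an edge set $E(H)\subseteq\{S\subseteq V(H): |S|=k\}$. For a $(k-1)$-set $S\subseteq V(H)$, its degree $d(S)$ is the number of edges containing $S$; the minimum codegree $\delta(H)$ is the minimum of $d(S)$ over all $(k-1)$-subsets $S$ of $V(H)$. For a $k$-graph $F$ and $n\in\mathbb N$, the codegree Turán number $\mathrm{ex}_{\mathrm{co}}(n,F)$ is the maximum $d$ such that there is an $n$-vertex $k$-graph $H$ containing no copy of $F$ with $\delta(H)\geq d$. The codegree Turán density is $\gamma(F)=\lim_{n\to\infty}\mathrm{ex}_{\mathrm{co}}(n,F)/n$ (this limit exists). -}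

module Defs where

open import Data.Nat using (ℕ; zero; suc; _+_; _*_; _∸_; _≤_; _<_; _≥_)
open import Data.Bool using (Bool; true; false; _∧_; if_then_else_)
open import Data.Fin using (Fin)
open import Data.Fin.Properties using (_≟_)
open import Data.Fin.Subset using (Subset; ∣_∣; _∪_; ⁅_⁆)
open import Data.Vec using (lookup; tabulate)
open import Data.List using (List; allFin; map)
open import Data.Nat.ListAction using (sum)
open import Data.Bool.ListAction using (any)
open import Data.Product using (Σ; _×_; ∃; ∃-syntax; _,_)
open import Relation.Binary.PropositionalEquality using (_≡_)
open import Relation.Nullary using (¬_)
open import Relation.Nullary.Decidable using (⌊_⌋)
open import Function.Definitions using (Injective)

record KGraph (k n : ℕ) : Set where
  field
    edge    : Subset n → Bool
    uniform : ∀ S → edge S ≡ true → ∣ S ∣ ≡ k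
open KGraph public

-- degree d(S) of a vertex set S: number of vertices v ∉ S with S ∪ {v} an edge,
-- i.e. the number of edges containing S when |S| = k - 1.
degree : ∀ {k n} → KGraph k n → Subset n → ℕ
degree {n = n} H S =
  sum (map (λ v → if lookup S v then 0 else (if edge H (S ∪ ⁅ v ⁆) then 1 else 0)) (allFin n))

image : ∀ {m n} → (Fin m → Fin n) → Subset m → Subset n
image {m} φ S = tabulate (λ w → any (λ v → lookup S v ∧ ⌊ φ v ≟ w ⌋) (allFin m))

ContainsCopy : ∀ {k m n} → KGraph k n → KGraph k m → Set
ContainsCopy {m = m} {n} H F =
  Σ (Fin m → Fin n) λ φ → Injective _≡_ _≡_ φ × (∀ S → edge F S ≡ true → edge H (image φ S) ≡ true)

Free : ∀ {k m n} → KGraph k n → KGraph k m → Set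
Free H F = ¬ ContainsCopy H F

-- δ(H) ≥ d is expressed as "every (k-1)-set has degree ≥ d"; the scaled
-- version c₂ · δ(H) ≥ c₁ · n: every (k-1)-set S has c₁ · n ≤ c₂ · d(S).
MinCodegAtLeast : ∀ {k n} → KGraph k n → (c₁ c₂ : ℕ) → Set
MinCodegAtLeast {k} {n} H c₁ c₂ = ∀ S → ∣ S ∣ ≡ k ∸ 1 → c₁ * n ≤ c₂ * degree H S

MinCodegAtMost : ∀ {k n} → KGraph k n → (u₁ u₂ : ℕ) → Set
MinCodegAtMost {k} {n} H u₁ u₂ = ∃[ S ] (∣ S ∣ ≡ k ∸ 1 × u₂ * degree H S ≤ u₁ * n)

-- γ(F) ≥ c₁/c₂ > 0 witnessed: for all large n, ex_co(n,F) ≥ (c₁/c₂) n,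
-- i.e. some F-free n-vertex k-graph has δ ≥ (c₁/c₂) n.
DensityAtLeast : ∀ {k m} → KGraph k m → (c₁ c₂ : ℕ) → Set
DensityAtLeast {k} F c₁ c₂ =
  ∃[ N ] ∀ n → N ≤ n → ∃[ H ] (Free {k} {n = n} H F × MinCodegAtLeast H c₁ c₂)

-- γ(F) ≤ u₁/u₂ witnessed: for all large n, ex_co(n,F) ≤ (u₁/u₂) n,
-- i.e. every F-free n-vertex k-graph has δ ≤ (u₁/u₂) n.
DensityAtMost : ∀ {k m} → KGraph k m → (u₁ u₂ : ℕ) → Set
DensityAtMost {k} F u₁ u₂ =
  ∃[ N ] ∀ n → N ≤ n → (H : KGraph k n) → Free H F → MinCodegAtMost H u₁ u₂

{-# OPTIONS --safe #-}

-- Write k = K + 1. F consists of two internally disjoint directed walks with common ends, of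
-- lengths differing by E, whose nodes are K-sets; an arc A → B stands for the edges A ∪ {v}, v ∈ B.
--
-- Lower bound: take as edges the k-sets of vertices with sum ≡ 1 modulo k^(E+1). Along an arc the
-- sum σ of a K-set becomes K - K σ, so k σ - K is multiplied by -K. As it is prime to k, the
-- two walks of F would force (-K)^E ≡ 1 modulo k^(E+1).
--
-- Upper bound: let every K-set have at least n / s neighbours. Among 2 s sets of density 1 / s
-- two overlap in positive density. Hence one can walk along pairs of disjoint K-sets with large
-- common neighbourhoods, and the density bound does not deteriorate with the length. Among R
-- consecutive pairs, the common neighbourhoods of some two overlap, and continuing inside the
-- overlap makes the part of the walk between them optional; its length lies in {1, …, R}.
-- Repeating this often enough, one length occurs so often that exactly E = R! steps can be
-- skipped. The walk through the first members of the pairs and the shortened walk through the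
-- second members form a copy of F.
module Submission where

open import Defs
open import Data.Nat renaming (_≟_ to _≟ℕ_)
open import Data.Nat.Properties hiding (_≟_; suc-injective)
open import Data.Nat.ListAction using (sum)
open import Data.Bool using (Bool; true; false; not; _∧_; if_then_else_)
import Data.Bool.Properties as Bool
open import Data.Fin using (Fin; zero; suc; toℕ; fromℕ<; combine; remQuot; _↑ˡ_; _↑ʳ_)
open import Data.Fin.Properties using (_≟_; toℕ-injective; toℕ-fromℕ<; any?; toℕ<n; remQuot-combine; combine-remQuot; combine-injective; ↑ˡ-injective; ↑ʳ-injective; suc-injective)
open import Data.Fin.Subset
open import Data.Fin.Subset.Properties
open import Data.List using (List; []; _∷_; _++_; length; map; allFin)
import Data.List as List
open import Data.List.Membership.Propositional using () renaming (_∈_ to _∈ₗ_; _∉_ to _∉ₗ_; lose to loseₗ; find to findₗ)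
import Data.List.Membership.Propositional.Properties as Mem
open import Data.List.Relation.Unary.All using (All; []; _∷_)
import Data.List.Relation.Unary.All as All
import Data.List.Relation.Unary.All.Properties as All
open import Data.List.Relation.Unary.Any using (Any; here; there)
import Data.List.Relation.Unary.Any as Any
import Data.List.Relation.Unary.Any.Properties as Any
open import Data.List.Relation.Unary.Unique.Propositional using (Unique)
open import Data.List.Relation.Unary.AllPairs using (AllPairs; []; _∷_)
import Data.List.Relation.Unary.AllPairs as AllPairs
import Data.List.Relation.Unary.AllPairs.Properties as AllPairs
import Data.List.Relation.Unary.Unique.Propositional.Properties as Unique
import Data.List.Properties as List
open import Data.Product using (Σ; _×_; ∃-syntax; _,_; proj₁; proj₂; uncurry)
open import Data.Sum using (_⊎_; inj₁; inj₂)
open import Data.Vec using (lookup; tabulate; []; _∷_)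
import Data.Vec as Vec
open import Data.Vec.Properties using ([]=⇒lookup; lookup⇒[]=; lookup∘tabulate; lookup-++ˡ; lookup-++ʳ; toList-++; toList∘fromList; ≡-dec)
open import Function using (_∘_; id; const; case_of_; Equivalence)
open import Function.Definitions using (Injective)
open import Relation.Binary.PropositionalEquality
open import Relation.Nullary
open import Relation.Nullary.Decidable using (⌊_⌋; toWitness; fromWitness; _×-dec_; ¬?)
open import Data.Nat.Solver using (module +-*-Solver)
open import Data.Unit using (tt) renaming (⊤ to Unit)
open import Data.List.Relation.Binary.Sublist.Propositional using ([]; _∷_; _∷ʳ_) renaming (_⊆_ to _⊑ₗ_; ⊆-refl to ⊑ₗ-refl)
import Data.List.Relation.Binary.Sublist.Propositional.Properties as Sub
open import Data.Nat.DivMod using (m≡m%n+[m/n]*n; [m+kn]%n≡m%n; %-distribˡ-+; m%n<n; m<n⇒m%n≡m; m%n%n≡m%n)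
open import Data.Nat.Divisibility using (_∣_; divides; *-monoʳ-∣; m≤n⇒m!∣n!; ∣⇒≤; ∣m+n∣m⇒∣n; ∣-trans; *-cancelˡ-∣; m∣m*n; ∣1⇒≡1)
open import Data.Nat.Coprimality using (Coprime; coprime-divisor)
import Data.Integer as ℤ
import Data.Integer.Properties as ℤ
import Data.Integer.Divisibility.Signed as ℤ
import Data.Integer.Solver as ℤ

private
  variable
    m n K : ℕ
    A B : Set

-- Subsets given by lists: images, weights, cardinalities

fromList : List (Fin n) → Subset n
fromList []       = ⊥
fromList (v ∷ vs) = fromList vs ∪ ⁅ v ⁆

∈-fromList⁺ : {v : Fin n} {vs : List (Fin n)} → v ∈ₗ vs → v ∈ fromList vs
∈-fromList⁺ (here refl) = q⊆p∪q _ _ (x∈⁅x⁆ _)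
∈-fromList⁺ (there v∈)  = p⊆p∪q _ (∈-fromList⁺ v∈)

∈-fromList⁻ : {v : Fin n} (vs : List (Fin n)) → v ∈ fromList vs → v ∈ₗ vs
∈-fromList⁻ []       v∈ = contradiction v∈ ∉⊥
∈-fromList⁻ (w ∷ vs) v∈ with x∈p∪q⁻ (fromList vs) ⁅ w ⁆ v∈
... | inj₁ v∈vs = there (∈-fromList⁻ vs v∈vs)
... | inj₂ v∈w  = here (x∈⁅y⁆⇒x≡y w v∈w)

∈-tabulate⁺ : {f : Fin n → Bool} {v : Fin n} → f v ≡ true → v ∈ tabulate f
∈-tabulate⁺ {f = f} {v} eq = lookup⇒[]= v (tabulate f) (trans (lookup∘tabulate f v) eq)

∈-tabulate⁻ : {f : Fin n → Bool} {v : Fin n} → v ∈ tabulate f → f v ≡ true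
∈-tabulate⁻ {f = f} {v} v∈ = trans (sym (lookup∘tabulate f v)) ([]=⇒lookup v∈)

∉⇒lookup≡false : {v : Fin n} {S : Subset n} → v ∉ S → lookup S v ≡ false
∉⇒lookup≡false {v = v} {S} v∉S with lookup S v in eq
... | true  = contradiction (lookup⇒[]= v S eq) v∉S
... | false = refl

image-fromList : (φ : Fin m → Fin n) (vs : List (Fin m)) →
                 image φ (fromList vs) ≡ fromList (map φ vs)
image-fromList {m} φ vs = ⊆-antisym to from
  where
  to : image φ (fromList vs) ⊆ fromList (map φ vs)
  to {w} w∈ with Any.satisfied (Any.any⁻ _ (allFin m) (Equivalence.from Bool.T-≡ (∈-tabulate⁻ w∈)))
  ... | v , t with Equivalence.to Bool.T-∧ t
  ... | v∈ , eq with refl ← toWitness {a? = φ v ≟ w} eq =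
    ∈-fromList⁺ (Mem.∈-map⁺ φ (∈-fromList⁻ vs (lookup⇒[]= v _ (Equivalence.to Bool.T-≡ v∈))))

  from : fromList (map φ vs) ⊆ image φ (fromList vs)
  from {w} w∈ with Mem.∈-map⁻ φ (∈-fromList⁻ (map φ vs) w∈)
  ... | v , v∈ , refl = ∈-tabulate⁺ (Equivalence.to Bool.T-≡ (Any.any⁺ _ (loseₗ (Mem.∈-allFin v)
        (Equivalence.from Bool.T-∧
          (Equivalence.from Bool.T-≡ ([]=⇒lookup (∈-fromList⁺ v∈)) , fromWitness refl)))))

-- Serves two purposes: with `const 1` it counts vertices, with `toℕ` it gives the sums whose
-- residues define the lower-bound graph.
weight : (Fin n → ℕ) → Subset n → ℕ
weight f []          = 0
weight f (true ∷ S)  = f zero + weight (f ∘ suc) S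
weight f (false ∷ S) = weight (f ∘ suc) S

weight-1 : (S : Subset n) → weight (const 1) S ≡ ∣ S ∣
weight-1 []          = refl
weight-1 (true ∷ S)  = cong suc (weight-1 S)
weight-1 (false ∷ S) = weight-1 S

weight-⊥ : (f : Fin n → ℕ) → weight f ⊥ ≡ 0
weight-⊥ {zero}  f = refl
weight-⊥ {suc n} f = weight-⊥ (f ∘ suc)

weight-insert : (f : Fin n → ℕ) {S : Subset n} {v : Fin n} → v ∉ S →
                weight f (S ∪ ⁅ v ⁆) ≡ f v + weight f S
weight-insert f {true ∷ S}  {zero} v∉ = contradiction Vec.here v∉
weight-insert f {false ∷ S} {zero} v∉ = cong (λ S′ → f zero + weight (f ∘ suc) S′) (∪-identityʳ S)
weight-insert f {false ∷ S} {suc v} v∉ = weight-insert (f ∘ suc) (v∉ ∘ Vec.there)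
weight-insert f {true ∷ S} {suc v} v∉ =
  trans (cong (f zero +_) (weight-insert (f ∘ suc) (v∉ ∘ Vec.there)))
        (trans (sym (+-assoc (f zero) _ _))
        (trans (cong (_+ weight (f ∘ suc) S) (+-comm (f zero) (f (suc v)))) (+-assoc (f (suc v)) _ _)))

weight-fromList : (f : Fin n → ℕ) {vs : List (Fin n)} → Unique vs →
                  weight f (fromList vs) ≡ sum (map f vs)
weight-fromList f []               = weight-⊥ f
weight-fromList f {v ∷ vs} (v∉ ∷ u) =
  trans (weight-insert f (λ v∈ → All.lookup v∉ (∈-fromList⁻ vs v∈) refl))
        (cong (f v +_) (weight-fromList f u))

∣insert∣ : {S : Subset n} {v : Fin n} → v ∉ S → ∣ S ∪ ⁅ v ⁆ ∣ ≡ suc ∣ S ∣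
∣insert∣ {S = S} {v} v∉ =
  trans (sym (weight-1 (S ∪ ⁅ v ⁆))) (trans (weight-insert (const 1) v∉) (cong suc (weight-1 S)))

∣fromList∣ : {vs : List (Fin n)} → Unique vs → ∣ fromList vs ∣ ≡ length vs
∣fromList∣ {n} [] = ∣⊥∣≡0 n
∣fromList∣ {vs = v ∷ vs} (v∉ ∷ u) =
  trans (∣insert∣ (λ v∈ → All.lookup v∉ (∈-fromList⁻ vs v∈) refl)) (cong suc (∣fromList∣ u))

∣p∪q∣+∣p∩q∣ : (p q : Subset n) → ∣ p ∪ q ∣ + ∣ p ∩ q ∣ ≡ ∣ p ∣ + ∣ q ∣
∣p∪q∣+∣p∩q∣ []          []          = refl
∣p∪q∣+∣p∩q∣ (true ∷ p)  (true ∷ q)  =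
  cong suc (trans (+-suc _ _) (trans (cong suc (∣p∪q∣+∣p∩q∣ p q)) (sym (+-suc _ _))))
∣p∪q∣+∣p∩q∣ (true ∷ p)  (false ∷ q) = cong suc (∣p∪q∣+∣p∩q∣ p q)
∣p∪q∣+∣p∩q∣ (false ∷ p) (true ∷ q)  = trans (cong suc (∣p∪q∣+∣p∩q∣ p q)) (sym (+-suc _ _))
∣p∪q∣+∣p∩q∣ (false ∷ p) (false ∷ q) = ∣p∪q∣+∣p∩q∣ p q

∣p∪q∣≤∣p∣+∣q∣ : (p q : Subset n) → ∣ p ∪ q ∣ ≤ ∣ p ∣ + ∣ q ∣
∣p∪q∣≤∣p∣+∣q∣ p q = ≤-trans (m≤m+n _ _) (≤-reflexive (∣p∪q∣+∣p∩q∣ p q))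

∣fromList∣≤ : (vs : List (Fin n)) → ∣ fromList vs ∣ ≤ length vs
∣fromList∣≤ {n} []   = ≤-reflexive (∣⊥∣≡0 n)
∣fromList∣≤ (v ∷ vs) = begin
  ∣ fromList vs ∪ ⁅ v ⁆ ∣     ≤⟨ ∣p∪q∣≤∣p∣+∣q∣ (fromList vs) ⁅ v ⁆ ⟩
  ∣ fromList vs ∣ + ∣ ⁅ v ⁆ ∣ ≡⟨ cong (∣ fromList vs ∣ +_) (∣⁅x⁆∣≡1 v) ⟩
  ∣ fromList vs ∣ + 1         ≤⟨ +-monoˡ-≤ 1 (∣fromList∣≤ vs) ⟩
  length vs + 1               ≡⟨ +-comm (length vs) 1 ⟩
  suc (length vs)             ∎
  where open ≤-Reasoning

fresh : (C : Subset n) (us : List (Fin n)) → length us < ∣ C ∣ → ∃[ v ] (v ∈ C × v ∉ₗ us)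
fresh C us l< with any? (λ v → (v ∈? C) ×-dec ¬? (v ∈? fromList us))
... | yes (v , v∈ , v∉) = v , v∈ , v∉ ∘ ∈-fromList⁺
... | no none = contradiction (≤-trans (p⊆q⇒∣p∣≤∣q∣ C⊆us) (∣fromList∣≤ us)) (<⇒≱ l<)
  where
  C⊆us : C ⊆ fromList us
  C⊆us {v} v∈ with v ∈? fromList us
  ... | yes v∈us = v∈us
  ... | no  v∉us = contradiction (v , v∈ , v∉us) none

-- Neighbourhoods and degrees

neighbours : ∀ {k} → KGraph k n → Subset n → Subset n
neighbours H S = tabulate λ v → not (lookup S v) ∧ edge H (S ∪ ⁅ v ⁆)

sum-indicator : (f : Fin m → Fin n) (p : Fin n → Bool) (g : Fin n → ℕ) →
                (∀ v → g v ≡ (if p v then 1 else 0)) →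
                sum (map g (List.tabulate f)) ≡ ∣ tabulate (p ∘ f) ∣
sum-indicator {zero}  f p g eq = refl
sum-indicator {suc m} f p g eq rewrite eq (f zero) with p (f zero)
... | true  = cong suc (sum-indicator (f ∘ suc) p g eq)
... | false = sum-indicator (f ∘ suc) p g eq

degree≡∣neighbours∣ : ∀ {k} (H : KGraph k n) (S : Subset n) → degree H S ≡ ∣ neighbours H S ∣
degree≡∣neighbours∣ H S = sum-indicator id (λ v → not (lookup S v) ∧ edge H (S ∪ ⁅ v ⁆)) _ same
  where
  same : ∀ v → (if lookup S v then 0 else (if edge H (S ∪ ⁅ v ⁆) then 1 else 0)) ≡
               (if not (lookup S v) ∧ edge H (S ∪ ⁅ v ⁆) then 1 else 0)
  same v with lookup S v
  ... | true  = refl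
  ... | false = refl

∈-neighbours⁺ : ∀ {k} (H : KGraph k n) {S : Subset n} {v : Fin n} →
                v ∉ S → edge H (S ∪ ⁅ v ⁆) ≡ true → v ∈ neighbours H S
∈-neighbours⁺ H v∉ e = ∈-tabulate⁺ (cong₂ _∧_ (cong not (∉⇒lookup≡false v∉)) e)

∈-neighbours⇒edge : ∀ {k} (H : KGraph k n) {S : Subset n} {v : Fin n} →
                    v ∈ neighbours H S → edge H (S ∪ ⁅ v ⁆) ≡ true
∈-neighbours⇒edge H {S} {v} v∈ with lookup S v | ∈-tabulate⁻ {f = λ v → not (lookup S v) ∧ edge H (S ∪ ⁅ v ⁆)} v∈
... | false | e = e

-- Two overlapping sets among many dense ones

-- The full decomposition of the list is kept because the order of `x` and `y` and the length of the
-- gap `ys` determine a shortcut later on.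
HasOverlap : (A → Subset n) → ℕ → List A → Set
HasOverlap {n = n} p M as =
  ∃[ zs ] ∃[ x ] ∃[ ys ] ∃[ y ] ∃[ xs ] (as ≡ zs ++ x ∷ ys ++ y ∷ xs × n ≤ M * ∣ p x ∩ p y ∣)

∣∩⋃∣≤ : (p : A → Subset n) (M c : ℕ) (q : Subset n) {as : List A} →
        All (λ a → M * ∣ q ∩ p a ∣ ≤ c) as → M * ∣ q ∩ ⋃ (map p as) ∣ ≤ length as * c
∣∩⋃∣≤ {n = n} p M c q {[]} [] = ≤-reflexive
  (trans (cong (λ S → M * ∣ S ∣) (∩-zeroʳ q)) (trans (cong (M *_) (∣⊥∣≡0 n)) (*-zeroʳ M)))
∣∩⋃∣≤ p M c q {a ∷ as} (small ∷ smalls) = begin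
  M * ∣ q ∩ (p a ∪ U) ∣                  ≡⟨ cong (λ S → M * ∣ S ∣) (∩-distribˡ-∪ q (p a) U) ⟩
  M * ∣ (q ∩ p a) ∪ (q ∩ U) ∣            ≤⟨ *-monoʳ-≤ M (∣p∪q∣≤∣p∣+∣q∣ (q ∩ p a) (q ∩ U)) ⟩
  M * (∣ q ∩ p a ∣ + ∣ q ∩ U ∣)          ≡⟨ *-distribˡ-+ M _ _ ⟩
  M * ∣ q ∩ p a ∣ + M * ∣ q ∩ U ∣        ≤⟨ +-mono-≤ small (∣∩⋃∣≤ p M c q smalls) ⟩
  c + length as * c                      ∎
  where
  open ≤-Reasoning
  U = ⋃ (map p as)

-- Bonferroni's inequality, scaled by `s * t`: the union has at least the total size minus all
-- pairwise intersections. Without an overlap each intersection costs at most `n`, and the number of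
-- pairs is bounded crudely by the square of the length.
overlap-or-large-union :
  (p : A → Subset n) (s t : ℕ) (as : List A) → All (λ a → n ≤ s * ∣ p a ∣) as →
  HasOverlap p (s * t) as ⊎
  (length as * (t * n) ≤ s * t * ∣ ⋃ (map p as) ∣ + length as * length as * n)
overlap-or-large-union p s t [] [] = inj₂ z≤n
overlap-or-large-union {n = n} p s t (a ∷ as) (big ∷ bigs) with overlap-or-large-union p s t as bigs
... | inj₁ (zs , x , ys , y , xs , refl , le) = inj₁ (a ∷ zs , x , ys , y , xs , refl , le)
... | inj₂ ih with Any.any? (λ b → n ≤? s * t * ∣ p a ∩ p b ∣) as
... | yes found =
  let b , b∈ , le = findₗ found
      ys , xs , eq = Mem.∈-∃++ b∈
  in inj₁ ([] , a , ys , b , xs , cong (a ∷_) eq , le)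
... | no none = inj₂ (begin
  (1 + l) * (t * n)                        ≡⟨⟩
  t * n + l * (t * n)                      ≤⟨ +-mono-≤ (*-monoʳ-≤ t big) ih ⟩
  t * (s * ∣ P ∣) + (M * ∣ U ∣ + l * l * n) ≡⟨ regroup t s ∣ P ∣ ∣ U ∣ (l * l * n) ⟩
  M * (∣ P ∣ + ∣ U ∣) + l * l * n          ≡⟨ cong (λ w → M * w + l * l * n) (sym (∣p∪q∣+∣p∩q∣ P U)) ⟩
  M * (∣ P ∪ U ∣ + ∣ P ∩ U ∣) + l * l * n  ≡⟨ cong (_+ l * l * n) (*-distribˡ-+ M ∣ P ∪ U ∣ ∣ P ∩ U ∣) ⟩
  M * ∣ P ∪ U ∣ + M * ∣ P ∩ U ∣ + l * l * n
    ≤⟨ +-monoˡ-≤ (l * l * n) (+-monoʳ-≤ (M * ∣ P ∪ U ∣) (∣∩⋃∣≤ p M n P smalls)) ⟩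
  -- The slack `n + l * n` completes the square `(1 + l) * (1 + l)`.
  M * ∣ P ∪ U ∣ + l * n + l * l * n        ≤⟨ m≤m+n _ (n + l * n) ⟩
  M * ∣ P ∪ U ∣ + l * n + l * l * n + (n + l * n) ≡⟨ square (M * ∣ P ∪ U ∣) l n ⟩
  M * ∣ P ∪ U ∣ + (1 + l) * (1 + l) * n    ∎)
  where
  open ≤-Reasoning
  open +-*-Solver
  l = length as
  M = s * t
  P = p a
  U = ⋃ (map p as)
  smalls : All (λ b → M * ∣ P ∩ p b ∣ ≤ n) as
  smalls = All.map (<⇒≤ ∘ ≰⇒>) (All.¬Any⇒All¬ as none)
  regroup : ∀ t s x u r → t * (s * x) + (s * t * u + r) ≡ s * t * (x + u) + r
  regroup = solve 5 (λ t s x u r → t :* (s :* x) :+ (s :* t :* u :+ r) := s :* t :* (x :+ u) :+ r) refl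
  square : ∀ x l n → x + l * n + l * l * n + (n + l * n) ≡ x + (1 + l) * (1 + l) * n
  square = solve 3 (λ x l n → x :+ l :* n :+ l :* l :* n :+ (n :+ l :* n) :=
                     x :+ (con 1 :+ l) :* (con 1 :+ l) :* n) refl

-- This is `s * t` with `t = 4 * s + 1`. For `2 * s` sets whose union has at most `n` elements, the
-- second alternative above reads `2 * s * t * n ≤ s * t * n + 4 * s * s * n`, that is `t ≤ 4 *
-- s`; so this `t` is the least that excludes it.
overlapFactor : ℕ → ℕ
overlapFactor s = s * (4 * s + 1)

dense⇒overlap : (p : A → Subset n) (s : ℕ) → 0 < s → 0 < n → (as : List A) → length as ≡ 2 * s →
          All (λ a → n ≤ s * ∣ p a ∣) as → HasOverlap p (overlapFactor s) as
dense⇒overlap {n = n} p s 0<s 0<n as len bigs with overlap-or-large-union p s (4 * s + 1) as bigs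
... | inj₁ found = found
... | inj₂ large rewrite len = contradiction large (<⇒≱ (begin-strict
  s * t * ∣ U ∣ + 2 * s * (2 * s) * n     ≤⟨ +-monoˡ-≤ _ (*-monoʳ-≤ (s * t) (∣p∣≤n U)) ⟩
  s * t * n + 2 * s * (2 * s) * n         <⟨ m<m+n _ (*-mono-≤ 0<s 0<n) ⟩
  s * t * n + 2 * s * (2 * s) * n + s * n ≡⟨ eq s n ⟩
  2 * s * (t * n)                         ∎))
  where
  open ≤-Reasoning
  open +-*-Solver
  t = 4 * s + 1
  U = ⋃ (map p as)
  eq : ∀ s n → s * (4 * s + 1) * n + 2 * s * (2 * s) * n + s * n ≡ 2 * s * ((4 * s + 1) * n)
  eq = solve 2 (λ s n → s :* (con 4 :* s :+ con 1) :* n :+ con 2 :* s :* (con 2 :* s) :* n :+ s :* n :=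
                  con 2 :* s :* ((con 4 :* s :+ con 1) :* n)) refl

m≤overlapFactor : ∀ s → s ≤ overlapFactor s
m≤overlapFactor s = ≤-trans (≤-reflexive (sym (*-identityʳ s))) (*-monoʳ-≤ s (m≤n+m 1 (4 * s)))

-- Subset sums of bounded numbers

data SubsetSum : List ℕ → ℕ → Set where
  []   : SubsetSum [] 0
  skip : ∀ {e es d} → SubsetSum es d → SubsetSum (e ∷ es) d
  take : ∀ {e es d} → SubsetSum es d → SubsetSum (e ∷ es) (e + d)

subsetSum-0 : ∀ es → SubsetSum es 0
subsetSum-0 []       = []
subsetSum-0 (e ∷ es) = skip (subsetSum-0 es)

-- Scan for the largest admissible value `suc r`. Either `q` copies are found, and they sum to
-- `q * suc r`, or deleting all copies costs at most `q` entries and lowers the bound to `r`.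
collect-or-remove :
  ∀ r q es → All (λ e → 1 ≤ e × e ≤ suc r) es →
  SubsetSum es (q * suc r) ⊎
  ∃[ es′ ] (All (λ e → 1 ≤ e × e ≤ r) es′ × (∀ {d} → SubsetSum es′ d → SubsetSum es d) ×
            length es ≤ length es′ + q)
collect-or-remove r zero    es       bounds = inj₁ (subsetSum-0 es)
collect-or-remove r (suc q) []       bounds = inj₂ ([] , [] , id , z≤n)
collect-or-remove r (suc q) (e ∷ es) ((1≤e , e≤) ∷ bounds) with m≤n⇒m<n∨m≡n e≤
... | inj₂ refl with collect-or-remove r q es bounds
...   | inj₁ sum = inj₁ (take sum)
...   | inj₂ (es′ , b , emb , le) =
  inj₂ (es′ , b , skip ∘ emb , ≤-trans (s≤s le) (≤-reflexive (sym (+-suc _ q))))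
collect-or-remove r (suc q) (e ∷ es) ((1≤e , e≤) ∷ bounds) | inj₁ e<
  with collect-or-remove r (suc q) es bounds
...   | inj₁ sum = inj₁ (skip sum)
...   | inj₂ (es′ , b , emb , le) =
  inj₂ (e ∷ es′ , (1≤e , ≤-pred e<) ∷ b , (λ { (skip t) → skip (emb t) ; (take t) → take (emb t) }) , s≤s le)

-- By pigeonhole some value e occurs E / e times.
subsetSum-multiple : ∀ r E es → All (λ e → 1 ≤ e × e ≤ r) es →
                     (∀ e → 1 ≤ e → e ≤ r → e ∣ E) → r * E < length es → SubsetSum es E
subsetSum-multiple zero E (e ∷ es) ((1≤e , e≤0) ∷ _) _ _ = contradiction (≤-trans 1≤e e≤0) λ ()
subsetSum-multiple (suc r) E es bounds divs long with divs (suc r) (s≤s z≤n) ≤-refl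
... | divides q refl with collect-or-remove r q es bounds
...   | inj₁ sum = sum
...   | inj₂ (es′ , b , emb , le) = emb (subsetSum-multiple r E es′ b
        (λ e 1≤e e≤ → divs e 1≤e (m≤n⇒m≤1+n e≤)) (+-cancelʳ-< q _ _ (begin-strict
          r * E + q        ≤⟨ +-monoʳ-≤ (r * E) (m≤m*n q (suc r)) ⟩
          r * E + E        ≡⟨ +-comm (r * E) E ⟩
          suc r * E        <⟨ long ⟩
          length es        ≤⟨ le ⟩
          length es′ + q   ∎)))
  where open ≤-Reasoning

-- Vertex blocks and their greedy choice

-- A `K`-set comes with an enumeration, so that the `i`-th vertex of a node of F has a definite
-- image.
record Block (K n : ℕ) : Set where
  field
    vertex    : Fin K → Fin n
    injective : Injective _≡_ _≡_ vertex
open Block public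


vertices : Block K n → List (Fin n)
vertices b = List.tabulate (vertex b)

support : Block K n → Subset n
support b = fromList (vertices b)

∣support∣ : (b : Block K n) → ∣ support b ∣ ≡ K
∣support∣ b = trans (∣fromList∣ (Unique.tabulate⁺ (injective b))) (List.length-tabulate (vertex b))

infix 4 _#_ _⊑_

_#_ : Block K n → Block K n → Set
b # c = ∀ i j → vertex b i ≢ vertex c j

#-sym : (b c : Block K n) → b # c → c # b
#-sym b c b#c i j eq = b#c j i (sym eq)

_⊑_ : Block K n → Subset n → Set
b ⊑ C = ∀ i → vertex b i ∈ C

pickVertices : ∀ j (us : List (Fin n)) (C : Subset n) → length us + j ≤ ∣ C ∣ →
               Σ (Block j n) λ b → b ⊑ C × (∀ i → vertex b i ∉ₗ us)
pickVertices zero us C room = record { vertex = λ () ; injective = λ { {()} } } , (λ ()) , (λ ())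
pickVertices (suc j) us C room
  with fresh C us (≤-trans (s≤s (m≤m+n _ j)) (≤-trans (≤-reflexive (sym (+-suc _ j))) room))
... | v , v∈ , v∉ with pickVertices j (v ∷ us) C (≤-trans (≤-reflexive (sym (+-suc _ j))) room)
... | b , b⊑ , b∉ = record { vertex = f ; injective = f-inj }
                  , (λ { zero → v∈ ; (suc i) → b⊑ i })
                  , (λ { zero → v∉ ; (suc i) → b∉ i ∘ there })
  where
  f : Fin (suc j) → Fin _
  f zero    = v
  f (suc i) = vertex b i
  f-inj : Injective _≡_ _≡_ f
  f-inj {zero}  {zero}  eq = refl
  f-inj {zero}  {suc j} eq = contradiction (here (sym eq)) (b∉ j)
  f-inj {suc i} {zero}  eq = contradiction (here eq) (b∉ i)
  f-inj {suc i} {suc j} eq = cong suc (injective b eq)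

pickBlock : (bs : List (Block K n)) (C : Subset n) → suc (length bs) * K ≤ ∣ C ∣ →
            ∃[ b ] (b ⊑ C × All (b #_) bs)
pickBlock {K} bs C room =
  let b , b⊑ , b∉ = pickVertices K (List.concatMap vertices bs) C
                      (≤-trans (≤-reflexive (trans (cong (_+ K) (len bs)) (+-comm (length bs * K) K))) room)
  in b , b⊑ , All.tabulate λ {c} c∈ i j eq →
       b∉ i (Mem.∈-concatMap⁺ vertices (loseₗ c∈ (subst (_∈ₗ vertices c) (sym eq) (Mem.∈-tabulate⁺ j))))
  where
  len : ∀ {n} (bs : List (Block K n)) → length (List.concatMap vertices bs) ≡ length bs * K
  len []       = refl
  len (b ∷ bs) = trans (List.length-++ (vertices b)) (cong₂ _+_ (List.length-tabulate (vertex b)) (len bs))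

-- Greedy: the old and new blocks together occupy at most `(length bs + q) * K` vertices, so `C` is
-- never exhausted.
pickBlocks : ∀ q (bs : List (Block K n)) (C : Subset n) → (length bs + q) * K ≤ ∣ C ∣ →
             ∃[ as ] (length as ≡ q × All (_⊑ C) as × AllPairs _#_ as × All (λ a → All (a #_) bs) as)
pickBlocks zero bs C room = [] , refl , [] , [] , []
pickBlocks {K} (suc q) bs C room
  with pickBlock bs C (≤-trans (*-monoˡ-≤ K (≤-trans (s≤s (m≤m+n (length bs) q)) (≤-reflexive (sym (+-suc (length bs) q))))) room)
... | b , b⊑ , b# with pickBlocks q (b ∷ bs) C (≤-trans (*-monoˡ-≤ K (≤-reflexive (sym (+-suc (length bs) q)))) room)
... | as , len , as⊑ , as# , as#bs =
  b ∷ as , cong suc len , b⊑ ∷ as⊑ , All.map (λ { {a} (a#b ∷ _) → #-sym a b a#b }) as#bs ∷ as#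
         , b# ∷ All.map All.tail as#bs

-- Walks in a graph of large codegree

AllPairs-++⁻ʳ : {R : A → A → Set} (xs : List A) {ys : List A} → AllPairs R (xs ++ ys) → AllPairs R ys
AllPairs-++⁻ʳ []       rs       = rs
AllPairs-++⁻ʳ (x ∷ xs) (_ ∷ rs) = AllPairs-++⁻ʳ xs rs

links : List A → List (A × A)
links []           = []
links (x ∷ [])     = []
links (x ∷ y ∷ zs) = (x , y) ∷ links (y ∷ zs)

-- The shortened walk revisits pairs of the long one; using different members of each pair keeps the
-- two walks disjoint.
record DoubleBlock (K n : ℕ) : Set where
  field
    fst snd : Block K n
open DoubleBlock public

module DenseGraph
  (H : KGraph (suc K) n) (s : ℕ) (0<s : 0 < s) (0<n : 0 < n)
  (dense : ∀ (S : Subset n) → ∣ S ∣ ≡ K → n ≤ s * degree H S)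
  where

  N : Block K n → Subset n
  N b = neighbours H (support b)

  NN : DoubleBlock K n → Subset n
  NN D = N (fst D) ∩ N (snd D)

  N-large : ∀ b → n ≤ s * ∣ N b ∣
  N-large b = subst (λ d → n ≤ s * d) (degree≡∣neighbours∣ H (support b)) (dense (support b) (∣support∣ b))

  -- Common neighbourhoods of pairs have density at least `1 / c₁`, overlaps of two of these at
  -- least `1 / c₂`, and `r` consecutive pairs force such an overlap. None of these depends on the
  -- length of the walk.
  c₁ c₂ r : ℕ
  c₁ = overlapFactor s
  c₂ = overlapFactor c₁
  r  = 2 * c₁

  0<c₁ : 0 < c₁
  0<c₁ = ≤-trans 0<s (m≤overlapFactor s)

  _⇐_ : Block K n → Block K n → Set
  b ⇐ a = b ⊑ N a

  top : Subset n → List (DoubleBlock K n) → Subset n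
  top C []      = C
  top C (D ∷ _) = NN D

  -- Lists of double blocks run backwards: the head is the most recent one.
  Tower : Subset n → List (DoubleBlock K n) → Set
  Tower C []       = Unit
  Tower C (D ∷ Ds) = (fst D ⊑ top C Ds × snd D ⊑ top C Ds) × Tower C Ds

  Tower-++⁻ʳ : ∀ {C} Ds {Es} → Tower C (Ds ++ Es) → Tower C Es
  Tower-++⁻ʳ []       t       = t
  Tower-++⁻ʳ (D ∷ Ds) (_ , t) = Tower-++⁻ʳ Ds t

  module Rooted
    (root : Block K n) (maxLen : ℕ)
    -- Space for the root, for both members of up to `maxLen` pairs, and for the `2 * s` candidates
    -- of one further step.
    (room : ∀ (C : Subset n) → n ≤ c₂ * ∣ C ∣ → (suc (2 * maxLen) + 2 * s) * K ≤ ∣ C ∣)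
    where

    blocks : List (DoubleBlock K n) → List (Block K n)
    blocks []       = root ∷ []
    blocks (D ∷ Ds) = fst D ∷ snd D ∷ blocks Ds

    length-blocks : ∀ Ds → length (blocks Ds) ≡ suc (2 * length Ds)
    length-blocks []       = refl
    length-blocks (D ∷ Ds) =
      cong suc (trans (cong suc (length-blocks Ds)) (sym (*-suc 2 (length Ds))))

    blocks-++⁻ʳ : ∀ Ds {Es} → AllPairs _#_ (blocks (Ds ++ Es)) → AllPairs _#_ (blocks Es)
    blocks-++⁻ʳ []       ps           = ps
    blocks-++⁻ʳ (D ∷ Ds) (_ ∷ _ ∷ ps) = blocks-++⁻ʳ Ds ps

    -- Any block inside `C` can continue the walk from either member of the latest pair. The
    -- existential `C′` forgets how the earlier part was built, so walks with a piece cut out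
    -- satisfy the same predicate.
    Ready : Subset n → List (DoubleBlock K n) → Set
    Ready C []       = C ⊆ N root
    Ready C (D ∷ Ds) = C ⊆ NN D × ∃[ C′ ] (fst D ⊑ C′ × snd D ⊑ C′ × Ready C′ Ds)

    Ready-⊆ : ∀ {C C′} Ds → C ⊆ C′ → Ready C′ Ds → Ready C Ds
    Ready-⊆ []       C⊆ C′⊆          = λ x∈ → C′⊆ (C⊆ x∈)
    Ready-⊆ (D ∷ Ds) C⊆ (C′⊆ , rest) = (λ x∈ → C′⊆ (C⊆ x∈)) , rest

    -- A tower depends on what lies below it only through `C`. Hence the same `Ds` fits on top of a
    -- path and on top of each of its shortened versions.
    Ready-++ : ∀ {C Xs} Ds → Tower C Ds → Ready C Xs → Ready (top C Ds) (Ds ++ Xs)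
    Ready-++ []       _                     ready = ready
    Ready-++ (D ∷ Ds) ((fst⊑ , snd⊑) , t)   ready = id , _ , fst⊑ , snd⊑ , Ready-++ Ds t ready

    -- Among `2 * s` fresh blocks in `C`, two have neighbourhoods that overlap. `C` only provides
    -- room; the density of `NN D` comes from the codegree, so it is not affected by that of `C`.
    step : ∀ C Xs → n ≤ c₂ * ∣ C ∣ → length Xs ≤ maxLen → AllPairs _#_ (blocks Xs) →
           ∃[ D ] (fst D ⊑ C × snd D ⊑ C × n ≤ c₁ * ∣ NN D ∣ × AllPairs _#_ (blocks (D ∷ Xs)))
    step C Xs large short disjoint
      with pickBlocks (2 * s) (blocks Xs) C
             (≤-trans (*-monoˡ-≤ K (+-monoˡ-≤ (2 * s) (≤-trans (≤-reflexive (length-blocks Xs))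
               (s≤s (*-monoʳ-≤ 2 short))))) (room C large))
    ... | as , len , as⊑ , as# , as#Xs with dense⇒overlap N s 0<s 0<n as len (All.tabulate λ {a} _ → N-large a)
    ... | zs , x , ys , y , xs , refl , le
      with x⊑ ∷ rest⊑ ← All.++⁻ʳ zs as⊑
         | x#Xs ∷ rest#Xs ← All.++⁻ʳ zs as#Xs
         | x#rest ∷ _ ← AllPairs-++⁻ʳ zs as# =
      record { fst = x ; snd = y } , x⊑ , All.head (All.++⁻ʳ ys rest⊑) , le ,
      (All.head (All.++⁻ʳ ys x#rest) ∷ x#Xs) ∷ All.head (All.++⁻ʳ ys rest#Xs) ∷ disjoint

    c₁-large⇒c₂-large : ∀ {C : Subset n} → n ≤ c₁ * ∣ C ∣ → n ≤ c₂ * ∣ C ∣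
    c₁-large⇒c₂-large {C} le = ≤-trans le (*-monoˡ-≤ ∣ C ∣ (m≤overlapFactor c₁))

    top-large : ∀ {C} Ds → n ≤ c₂ * ∣ C ∣ → All (λ D → n ≤ c₁ * ∣ NN D ∣) Ds → n ≤ c₂ * ∣ top C Ds ∣
    top-large []       large _         = large
    top-large (D ∷ Ds) large (le ∷ _)  = c₁-large⇒c₂-large {NN D} le

    run : ∀ i C Xs → n ≤ c₂ * ∣ C ∣ → i + length Xs ≤ maxLen → AllPairs _#_ (blocks Xs) →
          ∃[ Ds ] (length Ds ≡ i × Tower C Ds × All (λ D → n ≤ c₁ * ∣ NN D ∣) Ds ×
                   AllPairs _#_ (blocks (Ds ++ Xs)))
    run zero    C Xs large short disjoint = [] , refl , tt , [] , disjoint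
    run (suc i) C Xs large short disjoint with run i C Xs large (≤-trans (n≤1+n _) short) disjoint
    ... | Ds , refl , t , les , disjoint′
      with step (top C Ds) (Ds ++ Xs) (top-large Ds large les)
             (≤-trans (≤-reflexive (List.length-++ Ds)) (≤-trans (n≤1+n _) short)) disjoint′
    ... | D , fst⊑ , snd⊑ , le , disjoint″ =
      D ∷ Ds , refl , ((fst⊑ , snd⊑) , t) , le ∷ les , disjoint″

    -- skips are the lengths by which the walk along path can be shortened; any subset of
    -- the shortcuts can be used simultaneously.
    record Chain (j : ℕ) : Set where
      field
        end       : Subset n
        path      : List (DoubleBlock K n)
        skips     : List ℕ
        end-large : n ≤ c₂ * ∣ end ∣
        short     : length path ≤ j * r
        ready     : Ready end path
        disjoint  : AllPairs _#_ (blocks path)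
        skip-len  : length skips ≡ j
        skip-size : All (λ e → 1 ≤ e × e ≤ r) skips
        shortcut  : ∀ {d} → SubsetSum skips d →
                    ∃[ Ys ] (Ys ⊑ₗ path × Ready end Ys × length Ys + d ≡ length path)
    open Chain public

    -- Among r consecutive double blocks of a walk, two have common neighbourhoods x and y
    -- that overlap; continuing inside x ∩ y one can leave the walk at either of them.
    extend : ∀ {j} → suc j * r ≤ maxLen → Chain j → Chain (suc j)
    extend {j} bound ch
      with run r (end ch) (path ch) (end-large ch) (≤-trans (+-monoʳ-≤ r (short ch)) bound) (disjoint ch)
    ... | Ds , len , t , les , disj with dense⇒overlap NN c₁ 0<c₁ 0<n Ds len les
    -- Heads are most recent, so `zs` was built after `x` and is discarded. Leaving the walk at `y`
    -- already omits `x` and `ys`, which is `suc (length ys)` pairs.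
    ... | zs , x , ys , y , xs , refl , le = record
      { end       = NN x ∩ NN y
      ; path      = long ++ path ch
      ; skips     = suc (length ys) ∷ skips ch
      ; end-large = le
      ; short     = ≤-trans (≤-reflexive (List.length-++ long)) (+-mono-≤ long≤r (short ch))
      ; ready     = ready-long (ready ch)
      ; disjoint  = blocks-++⁻ʳ zs (subst (λ l → AllPairs _#_ (blocks l)) (List.++-assoc zs long (path ch)) disj)
      ; skip-len  = cong suc (skip-len ch)
      ; skip-size = (s≤s z≤n , ≤-trans (s≤s (≤-trans (m≤m+n (length ys) _)
                      (≤-reflexive (sym (List.length-++ ys))))) long≤r) ∷ skip-size ch
      ; shortcut  = shortcut′
      }
      where
      long = x ∷ ys ++ y ∷ xs
      tower-long = Tower-++⁻ʳ zs t
      long≤r : length long ≤ r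
      long≤r = ≤-trans (m≤n+m (length long) (length zs))
                 (≤-reflexive (trans (sym (List.length-++ zs)) len))
      ready-long : ∀ {Ys} → Ready (end ch) Ys → Ready (NN x ∩ NN y) (long ++ Ys)
      ready-long {Ys} rd = Ready-⊆ (long ++ Ys) (p∩q⊆p (NN x) (NN y)) (Ready-++ long tower-long rd)
      ready-short : ∀ {Ys} → Ready (end ch) Ys → Ready (NN x ∩ NN y) ((y ∷ xs) ++ Ys)
      ready-short {Ys} rd = Ready-⊆ (y ∷ xs ++ Ys) (p∩q⊆q (NN x) (NN y))
        (Ready-++ (y ∷ xs) (Tower-++⁻ʳ ys (proj₂ tower-long)) rd)
      open +-*-Solver
      eq : ∀ a b c d → suc a + c + (suc b + d) ≡ suc (b + suc a) + (c + d)
      eq = solve 4 (λ a b c d → con 1 :+ a :+ c :+ (con 1 :+ b :+ d) :=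
                      con 1 :+ (b :+ (con 1 :+ a)) :+ (c :+ d)) refl
      shortcut′ : ∀ {d} → SubsetSum (suc (length ys) ∷ skips ch) d →
                  ∃[ Ys ] (Ys ⊑ₗ long ++ path ch × Ready (NN x ∩ NN y) Ys ×
                           length Ys + d ≡ length (long ++ path ch))
      shortcut′ {d} (skip sum) with shortcut ch sum
      ... | Ys , sub , rd , l = long ++ Ys , Sub.++⁺ (⊑ₗ-refl {x = long}) sub , ready-long rd ,
        trans (cong (_+ d) (List.length-++ long)) (trans (+-assoc (length long) _ d)
          (trans (cong (length long +_) l) (sym (List.length-++ long))))
      shortcut′ (take {d = d} sum) with shortcut ch sum
      ... | Ys , sub , rd , l = (y ∷ xs) ++ Ys
        , Sub.++⁺ (_ ∷ʳ Sub.++⁺ˡ ys (⊑ₗ-refl {x = y ∷ xs})) sub , ready-short rd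
        , trans (cong (λ m → suc m + (suc (length ys) + d)) (List.length-++ xs))
          (trans (eq (length xs) (length ys) (length Ys) d)
          (trans (cong₂ (λ m m′ → suc m + m′) (sym (List.length-++ ys)) l) (sym (List.length-++ long))))

    chain : ∀ j → j * r ≤ maxLen → Chain j
    chain zero    _     = record
      { end = N root ; path = [] ; skips = [] ; end-large = ≤-trans (N-large root) (*-monoˡ-≤ ∣ N root ∣ s≤c₂)
      ; short = z≤n ; ready = id ; disjoint = [] ∷ [] ; skip-len = refl ; skip-size = []
      ; shortcut = λ { [] → [] , [] , id , refl } }
      where
      s≤c₂ : s ≤ c₂
      s≤c₂ = ≤-trans (m≤overlapFactor s) (m≤overlapFactor c₁)
    chain (suc j) bound = extend bound (chain j (≤-trans (m≤n+m (j * r) r) bound))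

    -- Abstracting over the projection `π` covers both the walk through first members and the walk
    -- through second members.
    links-ready : (π : DoubleBlock K n → Block K n) →
                  (∀ D C → fst D ⊑ C → snd D ⊑ C → π D ⊑ C) → (∀ D → NN D ⊆ N (π D)) →
                  ∀ {C} b Ds → b ⊑ C → Ready C Ds →
                  All (uncurry _⇐_) (links (b ∷ map π Ds ++ root ∷ []))
    links-ready π π⊑ NN⊆ b []       b⊑ C⊆ = (λ i → C⊆ (b⊑ i)) ∷ []
    links-ready π π⊑ NN⊆ b (D ∷ Ds) b⊑ (C⊆ , C′ , fst⊑ , snd⊑ , rd) =
      (λ i → NN⊆ D (C⊆ (b⊑ i))) ∷ links-ready π π⊑ NN⊆ (π D) Ds (π⊑ D C′ fst⊑ snd⊑) rd

    module _ {P : Block K n → Set} where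
      All-fst : ∀ Xs → All P (blocks Xs) → All P (map fst Xs)
      All-fst []       ps           = []
      All-fst (X ∷ Xs) (p ∷ _ ∷ ps) = p ∷ All-fst Xs ps

      All-snd : ∀ Xs → All P (blocks Xs) → All P (map snd Xs)
      All-snd []       ps           = []
      All-snd (X ∷ Xs) (_ ∷ p ∷ ps) = p ∷ All-snd Xs ps

      All-root : ∀ Xs → All P (blocks Xs) → P root
      All-root []       (p ∷ [])     = p
      All-root (X ∷ Xs) (_ ∷ _ ∷ ps) = All-root Xs ps

    blocks-⊑ₗ : ∀ {P : Block K n → Set} {Ys Xs} → Ys ⊑ₗ Xs → All P (blocks Xs) → All P (blocks Ys)
    blocks-⊑ₗ []          ps            = ps
    blocks-⊑ₗ (_ ∷ʳ sub)  (_ ∷ _ ∷ ps)  = blocks-⊑ₗ sub ps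
    blocks-⊑ₗ (refl ∷ sub) (p ∷ q ∷ ps) = p ∷ q ∷ blocks-⊑ₗ sub ps

    AllPairs-fst : ∀ Xs → AllPairs _#_ (blocks Xs) → AllPairs _#_ (map fst Xs)
    AllPairs-fst []       _                  = []
    AllPairs-fst (X ∷ Xs) ((_ ∷ ps) ∷ _ ∷ d) = All-fst Xs ps ∷ AllPairs-fst Xs d

    AllPairs-snd : ∀ {Ys Xs} → Ys ⊑ₗ Xs → AllPairs _#_ (blocks Xs) → AllPairs _#_ (map snd Ys)
    AllPairs-snd []           _            = []
    AllPairs-snd (_ ∷ʳ sub)   (_ ∷ _ ∷ d)  = AllPairs-snd sub d
    AllPairs-snd (_∷_ {xs = Ys} refl sub) (_ ∷ ps ∷ d) = All-snd Ys (blocks-⊑ₗ sub ps) ∷ AllPairs-snd sub d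

    -- A pair occurring in both lists contributes its first member on one side and its second on the
    -- other, and these are distinct entries of `blocks Xs`.
    cross : ∀ {Ys Xs} → Ys ⊑ₗ Xs → AllPairs _#_ (blocks Xs) →
            All (λ b → All (b #_) (map snd Ys)) (map fst Xs)
    cross []           _                        = []
    cross (_∷ʳ_ {xs = Ys} X sub) ((_ ∷ ps) ∷ _ ∷ d) = All-snd Ys (blocks-⊑ₗ sub ps) ∷ cross sub d
    cross (_∷_ {x = X} {xs = Ys} {ys = Xs} refl sub) ((p ∷ ps) ∷ qs ∷ d) =
      (p ∷ All-snd Ys (blocks-⊑ₗ sub ps)) ∷
      All.zipWith (λ { {b} (q , rest) → #-sym (snd X) b q ∷ rest }) (All-fst Xs qs , cross sub d)

    All-root-# : ∀ Xs → AllPairs _#_ (blocks Xs) → All (root #_) (map fst Xs)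
    All-root-# []       _                    = []
    All-root-# (X ∷ Xs) ((_ ∷ ps) ∷ _ ∷ d) = #-sym (fst X) root (All-root Xs ps) ∷ All-root-# Xs d

    All-root-#′ : ∀ {Ys Xs} → Ys ⊑ₗ Xs → AllPairs _#_ (blocks Xs) → All (root #_) (map snd Ys)
    All-root-#′ []             _            = []
    All-root-#′ (_ ∷ʳ sub)     (_ ∷ _ ∷ d)  = All-root-#′ sub d
    All-root-#′ (_∷_ {x = X} {ys = Xs} refl sub) (_ ∷ ps ∷ d) = #-sym (snd X) root (All-root Xs ps) ∷ All-root-#′ sub d

  record TwoWalks (L L′ : ℕ) : Set where
    field
      target root : Block K n
      us vs       : List (Block K n)
      length-us   : length us ≡ L
      length-vs   : length vs ≡ L′
      disjoint    : AllPairs _#_ (target ∷ root ∷ us ++ vs)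
      links-us    : All (uncurry _⇐_) (links (target ∷ us ++ root ∷ []))
      links-vs    : All (uncurry _⇐_) (links (target ∷ vs ++ root ∷ []))

  -- `suc (r * E)` rounds provide enough shortcuts for some of them to save exactly `E` steps. Each
  -- round adds at most `r` pairs, whence the bound `L′` on the length of the chain.
  twoWalks : ∀ E → (∀ e → 1 ≤ e → e ≤ r → e ∣ E) →
             let L′ = suc (r * E) * r in
             (∀ C → n ≤ c₂ * ∣ C ∣ → (suc (2 * (L′ + E)) + 2 * s) * K ≤ ∣ C ∣) →
             TwoWalks (L′ + E) L′
  twoWalks E divs room = record
    { target = T ; root = root ; us = map fst Xs ; vs = map snd Ys
    ; length-us = trans (List.length-map fst Xs) |Xs|
    ; length-vs = trans (List.length-map snd Ys) |Ys|
    ; disjoint  = (All-root Xs T# ∷ All.++⁺ (All-fst Xs T#) (All-snd Ys (blocks-⊑ₗ sub T#)))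
                ∷ (All.++⁺ (All-root-# Xs disj) (All-root-#′ sub disj))
                ∷ AllPairs.++⁺ (AllPairs-fst Xs disj) (AllPairs-snd sub disj) (cross sub disj)
    ; links-us  = links-ready fst (λ D C p q → p) (λ D → p∩q⊆p (N (fst D)) (N (snd D))) T Xs T⊑
                    (Ready-++ Ds tower (Chain.ready ch))
    ; links-vs  = links-ready snd (λ D C p q → q) (λ D → p∩q⊆q (N (fst D)) (N (snd D))) T Ys T⊑
                    (Ready-++ Ds tower ready′)
    }
    where
    L′ = suc (r * E) * r
    maxLen = L′ + E
    c₂-⊤ : n ≤ c₂ * ∣ ⊤ {n} ∣
    c₂-⊤ = ≤-trans (≤-reflexive (sym (∣⊤∣≡n n))) (≤-trans (≤-reflexive (sym (*-identityˡ _)))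
             (*-monoˡ-≤ ∣ ⊤ {n} ∣ (≤-trans 0<c₁ (m≤overlapFactor c₁))))
    rootPick = pickBlock [] ⊤ (≤-trans (*-monoˡ-≤ K (s≤s {n = 2 * maxLen + 2 * s} z≤n)) (room ⊤ c₂-⊤))
    root = proj₁ rootPick
    open Rooted root maxLen room
    ch : Chain (suc (r * E))
    ch = chain (suc (r * E)) (m≤m+n L′ E)
    cut = shortcut ch (subsetSum-multiple r E (skips ch) (skip-size ch) divs
            (≤-reflexive (sym (skip-len ch))))
    Ys₀ = proj₁ cut
    sub₀ = proj₁ (proj₂ cut)
    ready′ = proj₁ (proj₂ (proj₂ cut))
    path≤ : length (path ch) ≤ maxLen
    path≤ = ≤-trans (short ch) (m≤m+n L′ E)
    -- The length of the chain depends on `H`. Putting the same padding on the path and on its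
    -- shortened version makes the lengths exactly `L′ + E` and `L′`, as a fixed F requires.
    pad = run (maxLen ∸ length (path ch)) (end ch) (path ch) (end-large ch)
            (≤-reflexive (m∸n+n≡m path≤)) (Chain.disjoint ch)
    Ds = proj₁ pad
    tower = proj₁ (proj₂ (proj₂ pad))
    les = proj₁ (proj₂ (proj₂ (proj₂ pad)))
    disj = proj₂ (proj₂ (proj₂ (proj₂ pad)))
    Xs = Ds ++ path ch
    Ys = Ds ++ Ys₀
    sub : Ys ⊑ₗ Xs
    sub = Sub.++⁺ (⊑ₗ-refl {x = Ds}) sub₀
    |Xs| : length Xs ≡ maxLen
    |Xs| = trans (List.length-++ Ds) (trans (cong (_+ length (path ch)) (proj₁ (proj₂ pad))) (m∸n+n≡m path≤))
    |Ys| : length Ys ≡ L′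
    |Ys| = +-cancelʳ-≡ E _ _ (trans (cong (_+ E) (List.length-++ Ds)) (trans (+-assoc (length Ds) _ E)
             (trans (cong (length Ds +_) (proj₂ (proj₂ (proj₂ cut)))) (trans (sym (List.length-++ Ds)) |Xs|))))
    C = top (end ch) Ds
    targetPick = pickBlock (blocks Xs) C (≤-trans (*-monoˡ-≤ K (begin
        suc (length (blocks Xs))       ≡⟨ cong suc (length-blocks Xs) ⟩
        suc (suc (2 * length Xs))      ≡⟨ cong (λ l → suc (suc (2 * l))) |Xs| ⟩
        suc (suc (2 * maxLen))         ≡⟨ +-comm 1 (suc (2 * maxLen)) ⟩
        suc (2 * maxLen) + 1           ≤⟨ +-monoʳ-≤ (suc (2 * maxLen)) (≤-trans 0<s (m≤m+n s _)) ⟩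
        suc (2 * maxLen) + 2 * s       ∎)) (room C (top-large Ds (end-large ch) les)))
      where open ≤-Reasoning
    T = proj₁ targetPick
    T⊑ = proj₁ (proj₂ targetPick)
    T# = proj₂ (proj₂ targetPick)

-- The hypergraph F and its copies

⌊⌋⁻ : {P : Set} (d : Dec P) → ⌊ d ⌋ ≡ true → P
⌊⌋⁻ (yes p) _ = p

⌊⌋⁺ : {P : Set} (d : Dec P) → P → ⌊ d ⌋ ≡ true
⌊⌋⁺ (yes _) _ = refl
⌊⌋⁺ (no ¬p) p = contradiction p ¬p

links-map : (f : A → B) (xs : List A) → links (map f xs) ≡ map (λ (x , y) → f x , f y) (links xs)
links-map f []           = refl
links-map f (x ∷ [])     = refl
links-map f (x ∷ y ∷ zs) = cong (_ ∷_) (links-map f (y ∷ zs))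

links-irreflexive : {xs : List A} → Unique xs → All (λ (x , y) → x ≢ y) (links xs)
links-irreflexive []                = []
links-irreflexive ([] ∷ [])         = []
links-irreflexive ((x≢y ∷ _) ∷ u@(_ ∷ _)) = x≢y ∷ links-irreflexive u

All-lookup : {P : A → Set} (xs : Vec.Vec A m) → All P (Vec.toList xs) → ∀ i → P (lookup xs i)
All-lookup (x ∷ xs) (p ∷ ps) zero    = p
All-lookup (x ∷ xs) (p ∷ ps) (suc i) = All-lookup xs ps i

AllPairs-lookup : {R : A → A → Set} → (∀ x y → R x y → R y x) → (xs : Vec.Vec A m) →
                  AllPairs R (Vec.toList xs) → ∀ i j → i ≢ j → R (lookup xs i) (lookup xs j)
AllPairs-lookup R-sym (x ∷ xs) (r ∷ rs) zero    zero    i≢j = contradiction refl i≢j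
AllPairs-lookup R-sym (x ∷ xs) (r ∷ rs) zero    (suc j) i≢j = All-lookup xs r j
AllPairs-lookup R-sym (x ∷ xs) (r ∷ rs) (suc i) zero    i≢j = R-sym _ _ (All-lookup xs r i)
AllPairs-lookup R-sym (x ∷ xs) (r ∷ rs) (suc i) (suc j) i≢j =
  AllPairs-lookup R-sym xs rs i j (i≢j ∘ cong suc)

tabulate-lookup : (xs : Vec.Vec A m) → List.tabulate (lookup xs) ≡ Vec.toList xs
tabulate-lookup []       = refl
tabulate-lookup (x ∷ xs) = cong (x ∷_) (tabulate-lookup xs)

-- Walks are listed backwards, and an arc a → b appears as (b , a).
module Theta (K L L′ : ℕ) where

  Node : Set
  Node = Fin (2 + (L + L′))

  target root : Node
  target = zero
  root   = suc zero

  u : Fin L → Node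
  u i = suc (suc (i ↑ˡ L′))

  v : Fin L′ → Node
  v j = suc (suc (L ↑ʳ j))

  uWalk vWalk : List Node
  uWalk = target ∷ List.tabulate u ++ root ∷ []
  vWalk = target ∷ List.tabulate v ++ root ∷ []

  arcs : List (Node × Node)
  arcs = links uWalk ++ links vWalk

  code : Node → Fin K → Fin ((2 + (L + L′)) * K)
  code = combine

  edgeVertices : Node × Node → Fin K → List (Fin ((2 + (L + L′)) * K))
  edgeVertices (b , a) i = code b i ∷ List.tabulate (code a)

  -- The size condition makes uniformity immediate. It excludes no intended edge, since every arc
  -- joins distinct nodes; see `edge-theta`.
  IsEdge : Subset ((2 + (L + L′)) * K) → Set
  IsEdge S = ∣ S ∣ ≡ suc K × Any (λ arc → ∃[ i ] S ≡ fromList (edgeVertices arc i)) arcs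

  isEdge? : ∀ S → Dec (IsEdge S)
  isEdge? S = (∣ S ∣ ≟ℕ suc K) ×-dec
    Any.any? (λ arc → any? λ i → ≡-dec Bool._≟_ S (fromList (edgeVertices arc i))) arcs

  theta : KGraph (suc K) ((2 + (L + L′)) * K)
  theta = record
    { edge    = λ S → ⌊ isEdge? S ⌋
    ; uniform = λ S e → proj₁ (⌊⌋⁻ (isEdge? S) e)
    }

  walk-unique : ∀ {l} {f : Fin l → Node} → Injective _≡_ _≡_ f → (∀ i → target ≢ f i) → (∀ i → root ≢ f i) →
                Unique (target ∷ List.tabulate f ++ root ∷ [])
  walk-unique inj t≢ r≢ =
    All.++⁺ (All.tabulate⁺ t≢) ((λ ()) ∷ []) ∷
    AllPairs.++⁺ (Unique.tabulate⁺ inj) ([] ∷ []) (All.tabulate⁺ λ i → (r≢ i ∘ sym) ∷ [])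

  arcs-irreflexive : All (λ (b , a) → b ≢ a) arcs
  arcs-irreflexive = All.++⁺
    (links-irreflexive (walk-unique (↑ˡ-injective L′ _ _ ∘ suc-injective ∘ suc-injective) (λ _ ()) (λ _ ())))
    (links-irreflexive (walk-unique (↑ʳ-injective L _ _ ∘ suc-injective ∘ suc-injective) (λ _ ()) (λ _ ())))

  edgeVertices-unique : ∀ {b a} → b ≢ a → ∀ i → Unique (edgeVertices (b , a) i)
  edgeVertices-unique {b} {a} b≢a i =
    All.tabulate⁺ (λ j eq → b≢a (proj₁ (combine-injective b i a j eq))) ∷
    Unique.tabulate⁺ (λ {j} {j′} eq → proj₂ (combine-injective a j a j′ eq))

  edge-theta : ∀ {arc} → arc ∈ₗ arcs → ∀ i → edge theta (fromList (edgeVertices arc i)) ≡ true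
  edge-theta {arc} arc∈ i = ⌊⌋⁺ (isEdge? _)
    ( trans (∣fromList∣ (edgeVertices-unique (All.lookup arcs-irreflexive arc∈) i))
            (cong suc (List.length-tabulate (code (proj₂ arc))))
    , loseₗ arc∈ (i , refl))

  -- Vertex `i` of node `a` goes to vertex `i` of `β a`. An edge of F then becomes the support of
  -- `β a` with one vertex of `β b` added, and that vertex is a neighbour.
  embed : (H : KGraph (suc K) n) (β : Node → Block K n) → (∀ a b → a ≢ b → β a # β b) →
          All (λ (b , a) → β b ⊑ neighbours H (support (β a))) arcs → ContainsCopy H theta
  embed {n = n} H β β# β⇐ = φ , φ-injective , φ-edge
    where
    φ′ : Node × Fin K → Fin n
    φ′ (a , i) = vertex (β a) i

    φ : Fin ((2 + (L + L′)) * K) → Fin n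
    φ = φ′ ∘ remQuot K

    φ-combine : ∀ a i → φ (code a i) ≡ vertex (β a) i
    φ-combine a i = cong φ′ (remQuot-combine a i)

    φ′-injective : Injective _≡_ _≡_ φ′
    φ′-injective {a , i} {b , j} eq with a ≟ b
    ... | yes refl = cong (a ,_) (injective (β a) eq)
    ... | no  a≢b  = contradiction eq (β# a b a≢b i j)

    φ-injective : Injective _≡_ _≡_ φ
    φ-injective {x} {y} eq = trans (sym (combine-remQuot {2 + (L + L′)} K x))
      (trans (cong (uncurry combine) (φ′-injective eq)) (combine-remQuot {2 + (L + L′)} K y))

    φ-edge : ∀ S → edge theta S ≡ true → edge H (image φ S) ≡ true
    φ-edge S e with findₗ (proj₂ (⌊⌋⁻ (isEdge? S) e))
    ... | (b , a) , arc∈ , i , refl = subst (λ S′ → edge H S′ ≡ true) (sym (begin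
        image φ (fromList (edgeVertices (b , a) i))                     ≡⟨ image-fromList φ (edgeVertices (b , a) i) ⟩
        fromList (φ (code b i) ∷ map φ (List.tabulate (code a)))  ≡⟨ cong₂ (λ w ws → fromList (w ∷ ws)) (φ-combine b i)
          (trans (List.map-tabulate (code a) φ) (List.tabulate-cong (φ-combine a))) ⟩
        support (β a) ∪ ⁅ vertex (β b) i ⁆                              ∎))
      (∈-neighbours⇒edge H (All.lookup β⇐ arc∈ i))
      where open ≡-Reasoning

  embed-walks :
    (H : KGraph (suc K) n) (t r : Block K n) (us vs : List (Block K n)) →
    length us ≡ L → length vs ≡ L′ → AllPairs _#_ (t ∷ r ∷ us ++ vs) →
    All (λ (b , a) → b ⊑ neighbours H (support a)) (links (t ∷ us ++ r ∷ [])) →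
    All (λ (b , a) → b ⊑ neighbours H (support a)) (links (t ∷ vs ++ r ∷ [])) →
    ContainsCopy H theta
  embed-walks {n = n} H t r us vs refl refl disj us⇐ vs⇐ =
    embed H β (AllPairs-lookup #-sym bs (subst (AllPairs _#_) (sym toList-bs) disj))
      (All.++⁺ (along u us (image-u) us⇐) (along v vs image-v vs⇐))
    where
    Us = Vec.fromList us
    Vs = Vec.fromList vs
    -- The order agrees with the numbering of nodes by `target`, `root`, `u` and `v`.
    bs = t ∷ r ∷ (Us Vec.++ Vs)
    β : Node → Block K n
    β = lookup bs
    toList-bs : Vec.toList bs ≡ t ∷ r ∷ us ++ vs
    toList-bs = cong (λ l → t ∷ r ∷ l)
      (trans (toList-++ Us Vs) (cong₂ _++_ (toList∘fromList us) (toList∘fromList vs)))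
    image-u : List.tabulate (β ∘ u) ≡ us
    image-u = trans (List.tabulate-cong (lookup-++ˡ Us Vs)) (trans (tabulate-lookup Us) (toList∘fromList us))
    image-v : List.tabulate (β ∘ v) ≡ vs
    image-v = trans (List.tabulate-cong (lookup-++ʳ Us Vs)) (trans (tabulate-lookup Vs) (toList∘fromList vs))
    along : ∀ {l} (f : Fin l → Node) (ws : List (Block K n)) → List.tabulate (β ∘ f) ≡ ws →
            All (λ (b , a) → b ⊑ neighbours H (support a)) (links (t ∷ ws ++ r ∷ [])) →
            All (λ (b , a) → β b ⊑ neighbours H (support (β a))) (links (target ∷ List.tabulate f ++ root ∷ []))
    along f ws eq ws⇐ = All.map⁻ (subst (All _) (trans (cong links (sym walk)) (links-map β _)) ws⇐)
      where
      walk : map β (target ∷ List.tabulate f ++ root ∷ []) ≡ t ∷ ws ++ r ∷ []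
      walk = cong (t ∷_) (trans (List.map-++ β (List.tabulate f) (root ∷ []))
               (cong (_++ r ∷ []) (trans (List.map-tabulate f β) eq)))

-- The lower-bound graph and its codegree

module Residue (K M : ℕ) .{{_ : NonZero M}} (1<M : 1 < M) where

  -- Residue `1` leaves `σ ↦ K - K σ` without a fixed point when `M` is a positive power of `suc K`.
  -- With residue `0`, the multiples of `M` would span a complete subgraph.
  IsResidue : Subset n → Set
  IsResidue S = ∣ S ∣ ≡ suc K × weight toℕ S % M ≡ 1

  isResidue? : (S : Subset n) → Dec (IsResidue S)
  isResidue? S = (∣ S ∣ ≟ℕ suc K) ×-dec (weight toℕ S % M ≟ℕ 1)

  residueGraph : ∀ n → KGraph (suc K) n
  residueGraph n = record
    { edge    = λ S → ⌊ isResidue? S ⌋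
    ; uniform = λ S e → proj₁ (⌊⌋⁻ (isResidue? S) e)
    }

  -- Completing `S` to an edge means choosing a vertex outside `S` in one prescribed residue class.
  -- The class has at least `n / M` members, of which at most `K` lie in `S`.
  n/M≤degree+K : (S : Subset n) → ∣ S ∣ ≡ K → n / M ≤ degree (residueGraph n) S + K
  n/M≤degree+K {n} S ∣S∣≡K = begin
    n / M                          ≡⟨ sym (trans (∣fromList∣ witnesses-unique) (List.length-tabulate witness)) ⟩
    ∣ fromList witnesses ∣         ≤⟨ p⊆q⇒∣p∣≤∣q∣ witnesses⊆ ⟩
    ∣ neighbours G S ∪ S ∣         ≤⟨ ∣p∪q∣≤∣p∣+∣q∣ (neighbours G S) S ⟩
    ∣ neighbours G S ∣ + ∣ S ∣     ≡⟨ cong₂ _+_ (sym (degree≡∣neighbours∣ G S)) ∣S∣≡K ⟩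
    degree G S + K                 ∎
    where
    open ≤-Reasoning
    G = residueGraph n
    σ = weight toℕ S
    -- Congruent to `1 - σ` modulo `M`, written without subtraction.
    c = 1 + pred M * σ
    ρ = c % M

    c+σ≡1 : (c + σ) % M ≡ 1
    c+σ≡1 = begin-equality
      (1 + pred M * σ + σ) % M     ≡⟨ cong (_% M) (cong suc (trans (+-comm _ σ) (cong (_* σ) (suc-pred M)))) ⟩
      (1 + M * σ) % M              ≡⟨ cong (λ w → (1 + w) % M) (*-comm M σ) ⟩
      (1 + σ * M) % M              ≡⟨ [m+kn]%n≡m%n 1 σ M ⟩
      1 % M                        ≡⟨ m<n⇒m%n≡m 1<M ⟩
      1                            ∎

    bound : (j : Fin (n / M)) → ρ + toℕ j * M < n
    bound j = begin-strict
      ρ + toℕ j * M                <⟨ +-monoˡ-< (toℕ j * M) (m%n<n c M) ⟩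
      suc (toℕ j) * M              ≤⟨ *-monoˡ-≤ M (toℕ<n j) ⟩
      n / M * M                    ≤⟨ m≤n+m _ (n % M) ⟩
      n % M + n / M * M            ≡⟨ sym (m≡m%n+[m/n]*n n M) ⟩
      n                            ∎

    witness : Fin (n / M) → Fin n
    witness j = fromℕ< (bound j)

    witness-injective : Injective _≡_ _≡_ witness
    witness-injective {i} {j} eq = toℕ-injective (*-cancelʳ-≡ (toℕ i) (toℕ j) M
      (+-cancelˡ-≡ ρ _ _ (trans (sym (toℕ-fromℕ< (bound i))) (trans (cong toℕ eq) (toℕ-fromℕ< (bound j))))))

    witnesses = List.tabulate witness
    witnesses-unique : Unique witnesses
    witnesses-unique = Unique.tabulate⁺ witness-injective

    residue : ∀ j → (toℕ (witness j) + σ) % M ≡ 1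
    residue j = begin-equality
      (toℕ (witness j) + σ) % M                     ≡⟨ cong (λ w → (w + σ) % M) (toℕ-fromℕ< (bound j)) ⟩
      (ρ + toℕ j * M + σ) % M                       ≡⟨ %-distribˡ-+ (ρ + toℕ j * M) σ M ⟩
      ((ρ + toℕ j * M) % M + σ % M) % M             ≡⟨ cong (λ w → (w + σ % M) % M)
                                                        (trans ([m+kn]%n≡m%n ρ (toℕ j) M) (m%n%n≡m%n c M)) ⟩
      (c % M + σ % M) % M                           ≡⟨ sym (%-distribˡ-+ c σ M) ⟩
      (c + σ) % M                                   ≡⟨ c+σ≡1 ⟩
      1                                             ∎

    witnesses⊆ : fromList witnesses ⊆ neighbours G S ∪ S
    witnesses⊆ {v} v∈ with Mem.∈-tabulate⁻ (∈-fromList⁻ witnesses v∈) | v ∈? S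
    ... | _        | yes v∈S = q⊆p∪q (neighbours G S) S v∈S
    ... | j , refl | no v∉S  = p⊆p∪q S (∈-neighbours⁺ G v∉S (⌊⌋⁺ (isResidue? (S ∪ ⁅ v ⁆))
      (trans (∣insert∣ v∉S) (cong suc ∣S∣≡K) , trans (cong (_% M) (weight-insert toℕ v∉S)) (residue j))))

  -- Rounding `n / M` and discarding `S` cost at most `suc K` vertices, which for such `n` is at
  -- most half of the density `1 / M`.
  minCodegree : ∀ n → 2 * (M * suc K) ≤ n → MinCodegAtLeast (residueGraph n) 1 (2 * M)
  minCodegree n large S ∣S∣≡K = +-cancelʳ-≤ (2 * (M * suc K)) (1 * n) (2 * M * d) (begin
    1 * n + 2 * (M * suc K)              ≤⟨ +-monoʳ-≤ (1 * n) large ⟩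
    1 * n + n                            ≡⟨ double n ⟩
    2 * n                                ≡⟨ cong (2 *_) (m≡m%n+[m/n]*n n M) ⟩
    2 * (n % M + n / M * M)              ≤⟨ *-monoʳ-≤ 2 (+-mono-≤ (<⇒≤ (m%n<n n M)) (*-monoˡ-≤ M (n/M≤degree+K S ∣S∣≡K))) ⟩
    2 * (M + (d + K) * M)                ≡⟨ regroup M d K ⟩
    2 * M * d + 2 * (M * suc K)          ∎)
    where
    open ≤-Reasoning
    open +-*-Solver
    d = degree (residueGraph n) S
    double : ∀ n → 1 * n + n ≡ 2 * n
    double = solve 1 (λ n → con 1 :* n :+ n := con 2 :* n) refl
    regroup : ∀ M d K → 2 * (M + (d + K) * M) ≡ 2 * M * d + 2 * (M * suc K)
    regroup = solve 3 (λ M d K → con 2 :* (M :+ (d :+ K) :* M) :=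
                         con 2 :* M :* d :+ con 2 :* (M :* (con 1 :+ K))) refl

-- Arithmetic of the potential along walks

-- For an arc from A to B, take `x` to be the `K` vertices of B and `c` the sum of A: adding up the
-- edge conditions gives the sum of B as `K - K * c` modulo `M`.
sum-congruence : ∀ (x : Fin m → ℕ) c M → (∀ i → ∃[ q ] x i + c ≡ 1 + q * M) →
                 ∃[ q ] sum (List.tabulate x) + m * c ≡ m + q * M
sum-congruence {zero}  x c M cong₁ = 0 , refl
sum-congruence {suc m} x c M cong₁ with cong₁ zero | sum-congruence (x ∘ suc) c M (cong₁ ∘ suc)
... | q , eq | q′ , eq′ = q + q′ , (begin
  x zero + s + (c + m * c)      ≡⟨ shuffle (x zero) s c (m * c) ⟩
  (x zero + c) + (s + m * c)    ≡⟨ cong₂ _+_ eq eq′ ⟩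
  (1 + q * M) + (m + q′ * M)    ≡⟨ collect q q′ m M ⟩
  suc m + (q + q′) * M          ∎)
  where
  open ≡-Reasoning
  open +-*-Solver
  s = sum (List.tabulate (x ∘ suc))
  shuffle : ∀ a b c d → a + b + (c + d) ≡ (a + c) + (b + d)
  shuffle = solve 4 (λ a b c d → a :+ b :+ (c :+ d) := (a :+ c) :+ (b :+ d)) refl
  collect : ∀ q q′ m M → (1 + q * M) + (m + q′ * M) ≡ suc m + (q + q′) * M
  collect = solve 4 (λ q q′ m M → (con 1 :+ q :* M) :+ (m :+ q′ :* M) := con 1 :+ m :+ (q :+ q′) :* M) refl

coprime-pred : ∀ K → Coprime (suc K) K
coprime-pred K {d} (d∣sK , d∣K) = ∣1⇒≡1 (∣m+n∣m⇒∣n (subst (d ∣_) (+-comm 1 K) d∣sK) d∣K)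

-- One factor `k` is moved from the power into `x` at a time, so coprimality with `k` itself
-- suffices.
^∣-cancelˡ : ∀ {k c} → Coprime k c → .{{NonZero k}} → ∀ q x → k ^ q ∣ c * x → k ^ q ∣ x
^∣-cancelˡ {k} {c} cop zero    x _ = divides x (sym (*-identityʳ x))
^∣-cancelˡ {k} {c} cop (suc q) x d with coprime-divisor cop (∣-trans (m∣m*n (k ^ q)) d)
... | divides x′ refl = subst (k * k ^ q ∣_) (*-comm k x′) (*-monoʳ-∣ k (^∣-cancelˡ cop q x′
        (*-cancelˡ-∣ k (subst (k * k ^ q ∣_) (swap c x′ k) d))))
  where
  open +-*-Solver
  swap : ∀ c x k → c * (x * k) ≡ k * (c * x)
  swap = solve 3 (λ c x k → c :* (x :* k) := k :* (c :* x)) refl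

^∣-cancel-^ : ∀ {k c} → Coprime k c → .{{NonZero k}} → ∀ p q x → k ^ q ∣ c ^ p * x → k ^ q ∣ x
^∣-cancel-^ cop zero q x d = subst (_ ∣_) (*-identityˡ x) d
^∣-cancel-^ {k} {c} cop (suc p) q x d =
  ^∣-cancel-^ cop p q x (^∣-cancelˡ cop q (c ^ p * x) (subst (k ^ q ∣_) (*-assoc c (c ^ p) x) d))

open import Data.Integer using (ℤ; +_; -_)

-- Centred at the fixed point K / k of σ ↦ K - K σ, and scaled by k = K + 1.
potential : ℕ → ℕ → ℤ
potential K σ = + (suc K * σ) ℤ.- + K

-- The sum of potentials factors as `(K + 1) * (τ + K * σ - K)`, and the second factor is `q * M`.
potential-step : ∀ K M σ τ q → τ + K * σ ≡ K + q * M →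
                 + M ℤ.∣ potential K τ ℤ.+ + K ℤ.* potential K σ
potential-step K M σ τ q eq = ℤ.divides (+ (suc K * q)) (begin
  + (suc K * τ) ℤ.- k ℤ.+ k ℤ.* (+ (suc K * σ) ℤ.- k)
    ≡⟨ cong₂ (λ a b → a ℤ.- k ℤ.+ k ℤ.* (b ℤ.- k)) (ℤ.pos-* (suc K) τ) (ℤ.pos-* (suc K) σ) ⟩
  (+ 1 ℤ.+ k) ℤ.* + τ ℤ.- k ℤ.+ k ℤ.* ((+ 1 ℤ.+ k) ℤ.* + σ ℤ.- k)
    ≡⟨ factor k (+ τ) (+ σ) ⟩
  (+ 1 ℤ.+ k) ℤ.* (+ τ ℤ.+ k ℤ.* + σ ℤ.- k)
    ≡⟨ cong (λ w → (+ 1 ℤ.+ k) ℤ.* (w ℤ.- k)) eqℤ ⟩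
  (+ 1 ℤ.+ k) ℤ.* (k ℤ.+ + q ℤ.* + M ℤ.- k)
    ≡⟨ cancel k (+ q) (+ M) ⟩
  (+ 1 ℤ.+ k) ℤ.* + q ℤ.* + M
    ≡⟨ cong (ℤ._* + M) (sym (ℤ.pos-* (suc K) q)) ⟩
  + (suc K * q) ℤ.* + M ∎)
  where
  open ≡-Reasoning
  open ℤ.+-*-Solver
  k = + K
  eqℤ : + τ ℤ.+ k ℤ.* + σ ≡ k ℤ.+ + q ℤ.* + M
  eqℤ = trans (cong (λ w → + τ ℤ.+ w) (sym (ℤ.pos-* K σ))) (trans (cong (λ w → + w) eq) (cong (λ w → k ℤ.+ w) (ℤ.pos-* q M)))
  factor : ∀ k t s → (+ 1 ℤ.+ k) ℤ.* t ℤ.- k ℤ.+ k ℤ.* ((+ 1 ℤ.+ k) ℤ.* s ℤ.- k) ≡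
                     (+ 1 ℤ.+ k) ℤ.* (t ℤ.+ k ℤ.* s ℤ.- k)
  factor = solve 3 (λ k t s → (con (+ 1) :+ k) :* t :- k :+ k :* ((con (+ 1) :+ k) :* s :- k) :=
                     (con (+ 1) :+ k) :* (t :+ k :* s :- k)) refl
  cancel : ∀ k q m → (+ 1 ℤ.+ k) ℤ.* (k ℤ.+ q ℤ.* m ℤ.- k) ≡ (+ 1 ℤ.+ k) ℤ.* q ℤ.* m
  cancel = solve 3 (λ k q m → (con (+ 1) :+ k) :* (k :+ q :* m :- k) := (con (+ 1) :+ k) :* q :* m) refl

-- Every arc multiplies the potential by `- K` modulo `M`, and a walk with `length ws` interior
-- nodes has one arc more than that.
walk-potential : ∀ (K M : ℕ) (y : A → ℤ) (t r : A) (ws : List A) →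
                 All (λ (b , a) → + M ℤ.∣ y b ℤ.+ + K ℤ.* y a) (links (t ∷ ws ++ r ∷ [])) →
                 + M ℤ.∣ y t ℤ.- (- + K) ℤ.^ suc (length ws) ℤ.* y r
walk-potential K M y t r [] (d ∷ []) = subst (+ M ℤ.∣_) (eq (+ K) (y t) (y r)) d
  where
  open ℤ.+-*-Solver
  eq : ∀ k t r → t ℤ.+ k ℤ.* r ≡ t ℤ.- (- k ℤ.* + 1) ℤ.* r
  eq = solve 3 (λ k t r → t :+ k :* r := t :- (:- k :* con (+ 1)) :* r) refl
walk-potential K M y t r (w ∷ ws) (d ∷ ds) =
  subst (+ M ℤ.∣_) (eq (+ K) (y t) (y w) (y r) ((- + K) ℤ.^ suc (length ws)))
    (ℤ.∣m∣n⇒∣m-n d (ℤ.∣n⇒∣m*n (+ K) (walk-potential K M y w r ws ds)))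
  where
  open ℤ.+-*-Solver
  eq : ∀ k t w r p → t ℤ.+ k ℤ.* w ℤ.- k ℤ.* (w ℤ.- p ℤ.* r) ≡ t ℤ.- (- k ℤ.* p) ℤ.* r
  eq = solve 5 (λ k t w r p → t :+ k :* w :- k :* (w :- p :* r) := t :- (:- k :* p) :* r) refl

abs-^ : ∀ i p → ℤ.∣ i ℤ.^ p ∣ ≡ ℤ.∣ i ∣ ^ p
abs-^ i zero    = refl
abs-^ i (suc p) = trans (ℤ.abs-* i (i ℤ.^ p)) (cong (ℤ.∣ i ∣ *_) (abs-^ i p))

-- A common divisor of `suc K` and the potential also divides `suc K * σ`, hence their difference
-- `K`.
coprime-potential : ∀ K σ → Coprime (suc K) ℤ.∣ potential K σ ∣
coprime-potential K σ {d} (d∣k , d∣y) = coprime-pred K (d∣k , ℤ.∣⇒∣ᵤ {+ d} {+ K} (subst (+ d ℤ.∣_) eq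
  (ℤ.∣m∣n⇒∣m-n {m = + (suc K * σ)} (ℤ.∣ᵤ⇒∣ (∣-trans d∣k (m∣m*n σ))) (ℤ.∣ᵤ⇒∣ {+ d} {potential K σ} d∣y))))
  where
  open ℤ.+-*-Solver
  eq : + (suc K * σ) ℤ.- potential K σ ≡ + K
  eq = solve 2 (λ a b → a :- (a :- b) := b) refl (+ (suc K * σ)) (+ K)

-- Otherwise k ^ (E + 1) would divide 1 - (-K) ^ E, which is nonzero and too small.
walks-incongruent : ∀ K E p σ → 2 ≤ K → 1 ≤ E →
                    let z = - + K ; y = potential K σ in
                    ¬ (+ (suc K ^ suc E) ℤ.∣ z ℤ.^ p ℤ.* y ℤ.- z ℤ.^ (p + E) ℤ.* y)
walks-incongruent K E p σ 2≤K 1≤E d = contradiction (∣⇒≤ {{D-nonZero}} d₃) (<⇒≱ small)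
  where
  open ≤-Reasoning
  z = - + K
  y = potential K σ
  D = + 1 ℤ.- z ℤ.^ E
  k = suc K
  ∣z∣ : ℤ.∣ z ∣ ≡ K
  ∣z∣ = ℤ.∣-i∣≡∣i∣ (+ K)
  ∣z^E∣ : ℤ.∣ z ℤ.^ E ∣ ≡ K ^ E
  ∣z^E∣ = trans (abs-^ z E) (cong (_^ E) ∣z∣)
  2≤K^E : 2 ≤ K ^ E
  2≤K^E = ≤-trans 2≤K (≤-trans (≤-reflexive (sym (^-identityʳ K))) (^-monoʳ-≤ K {{>-nonZero (≤-trans (s≤s z≤n) 2≤K)}} 1≤E))
  factored : z ℤ.^ p ℤ.* y ℤ.- z ℤ.^ (p + E) ℤ.* y ≡ z ℤ.^ p ℤ.* (y ℤ.* D)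
  factored = trans (cong (λ w → z ℤ.^ p ℤ.* y ℤ.- w ℤ.* y) (ℤ.^-distribˡ-+-* z p E))
    (solve 3 (λ a b y → a :* y :- a :* b :* y := a :* (y :* (con (+ 1) :- b))) refl (z ℤ.^ p) (z ℤ.^ E) y)
    where open ℤ.+-*-Solver
  d₁ : k ^ suc E ∣ K ^ p * (ℤ.∣ y ∣ * ℤ.∣ D ∣)
  d₁ = subst (k ^ suc E ∣_)
    (trans (cong ℤ.∣_∣ factored) (trans (ℤ.abs-* (z ℤ.^ p) (y ℤ.* D))
      (cong₂ _*_ (trans (abs-^ z p) (cong (_^ p) ∣z∣)) (ℤ.abs-* y D)))) (ℤ.∣⇒∣ᵤ d)
  d₂ : k ^ suc E ∣ ℤ.∣ y ∣ * ℤ.∣ D ∣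
  d₂ = ^∣-cancel-^ (coprime-pred K) p (suc E) _ d₁
  d₃ : k ^ suc E ∣ ℤ.∣ D ∣
  d₃ = ^∣-cancelˡ (coprime-potential K σ) (suc E) _ d₂
  -- The place where uniformity at least 3 is essential: for `K = 1` and even `E` the power
  -- `(- K) ^ E` equals 1, whereas here its absolute value is at least 2.
  D-nonZero : NonZero ℤ.∣ D ∣
  D-nonZero = ≢-nonZero λ ∣D∣≡0 → contradiction
    (trans (sym ∣z^E∣) (cong ℤ.∣_∣ (sym (ℤ.i-j≡0⇒i≡j (+ 1) (z ℤ.^ E) (ℤ.∣i∣≡0⇒i≡0 ∣D∣≡0)))))
    (λ eq → <⇒≢ 2≤K^E (sym eq))
  small : ℤ.∣ D ∣ < k ^ suc E
  small = begin-strict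
    ℤ.∣ D ∣                       ≤⟨ ℤ.∣i-j∣≤∣i∣+∣j∣ (+ 1) (z ℤ.^ E) ⟩
    1 + ℤ.∣ z ℤ.^ E ∣             ≡⟨ cong suc ∣z^E∣ ⟩
    1 + K ^ E                     <⟨ +-monoˡ-< (K ^ E) 2≤K^E ⟩
    K ^ E + K ^ E                 ≤⟨ +-monoʳ-≤ (K ^ E) (≤-trans (m≤m+n (K ^ E) 0) (*-monoˡ-≤ (K ^ E) (≤-trans (s≤s z≤n) 2≤K))) ⟩
    k * K ^ E                     ≤⟨ *-monoʳ-≤ k (^-monoˡ-≤ E (n≤1+n K)) ⟩
    k ^ suc E                     ∎

-- The two density bounds

module _ (K L′ E : ℕ) (2≤K : 2 ≤ K) (1≤E : 1 ≤ E) where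
  open Theta K (L′ + E) L′

  private
    M = suc K ^ suc E
    instance
      M-nonZero : NonZero M
      M-nonZero = m^n≢0 (suc K) (suc E)

    1<M : 1 < M
    1<M = ≤-trans (s≤s (≤-trans (s≤s z≤n) 2≤K)) (≤-trans (≤-reflexive (sym (^-identityʳ (suc K))))
            (^-monoʳ-≤ (suc K) (s≤s (z≤n {E}))))

  open Residue K M 1<M

  -- In a copy, both walks express the potential of `target` through that of `root`, with exponents
  -- of `- K` that differ by `E`. Subtracting gives the congruence refuted by `walks-incongruent`.
  residueGraph-free : ∀ n → Free (residueGraph n) theta
  residueGraph-free n (φ , φ-injective , φ-edge) = walks-incongruent K E (suc L′) (σ root) 2≤K 1≤E
    (subst (+ M ℤ.∣_) (cancel (y target) _ _)
      (ℤ.∣m∣n⇒∣m-n (walk u (λ arc∈ → Mem.∈-++⁺ˡ arc∈)) (walk v (λ arc∈ → Mem.∈-++⁺ʳ (links uWalk) arc∈))))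
    where
    x : Node → Fin K → ℕ
    x a i = toℕ (φ (code a i))

    σ : Node → ℕ
    σ a = sum (List.tabulate (x a))

    y : Node → ℤ
    y a = potential K (σ a)

    vertex-congruence : ∀ {b a} → (b , a) ∈ₗ arcs → ∀ i → ∃[ q ] x b i + σ a ≡ 1 + q * M
    vertex-congruence {b} {a} arc∈ i = (x b i + σ a) / M ,
      trans (m≡m%n+[m/n]*n (x b i + σ a) M) (cong (_+ (x b i + σ a) / M * M) (begin
        (x b i + σ a) % M                              ≡⟨ cong (λ l → (x b i + sum l) % M)
          (sym (trans (cong (map toℕ) (List.map-tabulate (code a) φ)) (List.map-tabulate (φ ∘ code a) toℕ))) ⟩
        sum (map toℕ (map φ e)) % M                    ≡⟨ cong (_% M) (sym (weight-fromList toℕ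
          (Unique.map⁺ φ-injective (edgeVertices-unique (All.lookup arcs-irreflexive arc∈) i)))) ⟩
        weight toℕ (fromList (map φ e)) % M            ≡⟨ cong (λ S → weight toℕ S % M) (sym (image-fromList φ e)) ⟩
        weight toℕ (image φ (fromList e)) % M          ≡⟨ proj₂ (⌊⌋⁻ (isResidue? (image φ (fromList e))) (φ-edge (fromList e) (edge-theta arc∈ i))) ⟩
        1                                              ∎))
      where
      open ≡-Reasoning
      e = edgeVertices (b , a) i

    arc-potential : ∀ {arc} → arc ∈ₗ arcs → + M ℤ.∣ y (proj₁ arc) ℤ.+ + K ℤ.* y (proj₂ arc)
    arc-potential {b , a} arc∈ =
      let q , eq = sum-congruence (x b) (σ a) M (vertex-congruence arc∈)
      in potential-step K M (σ a) (σ b) q eq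

    walk : ∀ {l} (f : Fin l → Node) → (∀ {arc} → arc ∈ₗ links (target ∷ List.tabulate f ++ root ∷ []) → arc ∈ₗ arcs) →
           + M ℤ.∣ y target ℤ.- (- + K) ℤ.^ suc l ℤ.* y root
    walk f sub = subst (λ l → + M ℤ.∣ y target ℤ.- (- + K) ℤ.^ suc l ℤ.* y root) (List.length-tabulate f)
      (walk-potential K M y target root (List.tabulate f) (All.tabulate λ arc∈ → arc-potential (sub arc∈)))

    cancel : ∀ t a b → (t ℤ.- a) ℤ.- (t ℤ.- b) ≡ b ℤ.- a
    cancel = solve 3 (λ t a b → (t :- a) :- (t :- b) := b :- a) refl
      where open ℤ.+-*-Solver

  theta-densityAtLeast : DensityAtLeast theta 1 (2 * M)
  theta-densityAtLeast = 2 * (M * suc K) , λ n large →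
    residueGraph n , residueGraph-free n , minCodegree n large

module _ (K s : ℕ) (0<s : 0 < s) (E : ℕ) where

  private
    R L′ : ℕ
    R  = 2 * overlapFactor s
    L′ = suc (R * E) * R

  open Theta K (L′ + E) L′

  -- Either exhaustive search finds a `K`-set of degree at most `n / s`, or all degrees exceed it
  -- and the two walks exist. The threshold on `n` makes every set of density `1 / c` larger than
  -- `room`.
  theta-densityAtMost : (∀ e → 1 ≤ e → e ≤ R → e ∣ E) → DensityAtMost theta 1 s
  theta-densityAtMost divs = suc (c * room) , λ n large H free →
    case anySubset? (λ S → (∣ S ∣ ≟ℕ K) ×-dec (s * degree H S ≤? 1 * n)) of λ where
      (yes small) → small
      (no  none)  → contradiction (copy n large H λ S ∣S∣≡K →
        ≤-trans (≤-reflexive (sym (*-identityˡ n))) (<⇒≤ (≰⇒> λ le → none (S , ∣S∣≡K , le)))) free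
    where
    c room : ℕ
    c = overlapFactor (overlapFactor s)
    room = (suc (2 * (L′ + E)) + 2 * s) * K
    copy : ∀ n → suc (c * room) ≤ n → (H : KGraph (suc K) n) →
           (∀ S → ∣ S ∣ ≡ K → n ≤ s * degree H S) → ContainsCopy H theta
    copy n large H dense = embed-walks H W.target W.root W.us W.vs W.length-us W.length-vs W.disjoint W.links-us W.links-vs
      where
      open DenseGraph H s 0<s (≤-trans (s≤s z≤n) large) dense
      module W = TwoWalks (twoWalks E divs λ C le → <⇒≤ (*-cancelˡ-< c room ∣ C ∣ (≤-trans large le)))

theorem1p1 : (a b : ℕ) → 0 < a → 0 < b → (k : ℕ) → k ≥ 3 →
    ∃[ m ] Σ (KGraph k m) λ F →
    (∃[ c₁ ] ∃[ c₂ ] (0 < c₁ × 0 < c₂ × DensityAtLeast F c₁ c₂)) ×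
    (∃[ u₁ ] ∃[ u₂ ] (0 < u₂ × u₁ * b < a * u₂ × DensityAtMost F u₁ u₂))
theorem1p1 a b 0<a 0<b (suc K) (s≤s 2≤K) =
  _ , Theta.theta K (L′ + E) L′ ,
  (1 , 2 * suc K ^ suc E , s≤s z≤n , ≤-trans (m^n>0 (suc K) (suc E)) (m≤m+n (suc K ^ suc E) _) ,
    theta-densityAtLeast K L′ E 2≤K (1≤n! R)) ,
  (1 , s , s≤s z≤n , ≤-trans (≤-reflexive (cong suc (*-identityˡ b))) (≤-trans (≤-reflexive (sym (*-identityˡ s))) (*-monoˡ-≤ s 0<a)) ,
    theta-densityAtMost K s (s≤s z≤n) E λ { (suc e) _ e≤R → ∣-trans (m∣m*n (e !)) (m≤n⇒m!∣n! e≤R) })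
  where
  -- Since `a` is at least 1, `1 / (b + 1)` lies strictly below `a / b`.
  s  = suc b
  R  = 2 * overlapFactor s
  E  = R !
  L′ = suc (R * E) * R
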